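{- Let $\mathbf i=(i_1,i_2,\dots)\in\mathbb{N}^{\mathbb{N}}$ and let $\mu_{\mathbf i}$ be the corresponding infinite mutation sequence on $\mathbf{AF}$. Then: (i) $\mathcal D_{\mathbf{AF}}(\mu_{\mathbf i})$ is dense in $\mathbf{AF}$; (ii) if no $i\in\mathbb{N}$ appears infinitely many times in $\mathbf i$, then $\mathcal C_{\mathbf{AF}}(\mu_{\mathbf i})$ is dense in $\mathbf{AF}$; (iii) if only finitely many distinct $i\in\mathbb{N}$ appear in $\mathbf i$, then $\mathcal C_{\mathbf{AF}}(\mu_{\mathbf i})$ is not dense in $\mathbf{AF}$.
   Context: $\mathbb{N}$ is the positive integers. A quiver on $\mathbb{N}$ is a function $Q:\mathbb{N}\times\mathbb{N}\to\mathbb{Z}$ with $Q(x,y)=-Q(y,x)$. For $V\subseteq\mathbb{N}$, $\rho_V(Q)(x,y)=Q(x,y)$ if $x,y\in V$, else $0$. $\mathbf{AF}$ is the set of all quivers on $\mathbb{N}$ with the topology generated by the basic sets $U_{Q,V}=\{Q':\rho_V(Q')=\rho_V(Q)\}$, $V$ finite. Mutation at $x$: $\mu_x(Q)(v,w)=-Q(v,w)$ if $x\in\{v,w\}$, and otherwise $\mu_x(Q)(v,w)=Q(v,w)+Q(v,x)[Q(x,w)]_++[-Q(v,x)]_+Q(x,w)$, where $[a]_+=\max(a,0)$. For $\mathbf i\in\mathbb{N}^{\mathbb{N}}$, $\mu_{\mathbf i}$ converges on $Q$ if the sequence $(\mu_{i_m}\circ\cdots\circ\mu_{i_1}(Q))_{m\ge1}$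 converges in $\mathbf{AF}$, and diverges on $Q$ otherwise. $\mathcal C_{\mathbf{AF}}(\mu_{\mathbf i})$ is the set of $Q\in\mathbf{AF}$ on which $\mu_{\mathbf i}$ converges and $\mathcal D_{\mathbf{AF}}(\mu_{\mathbf i})=\mathbf{AF}\setminus\mathcal C_{\mathbf{AF}}(\mu_{\mathbf i})$. -}

module Defs where

open import Data.Nat using (ℕ; zero; suc; _≤_)
open import Data.Nat.Properties using (_≟_)
open import Data.Integer using (ℤ; _+_; _*_; -_; _⊔_; 0ℤ)
open import Data.List using (List)
open import Data.List.Membership.Propositional using (_∈_)
open import Data.Product using (Σ; ∃; _×_)
open import Relation.Nullary using (¬_; yes; no)
open import Relation.Binary.PropositionalEquality using (_≡_)

-- Vertices: Agda's ℕ (0,1,2,...) stands for the paper's positive integers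
-- via the relabelling n ↦ n+1.

RawQuiver : Set
RawQuiver = ℕ → ℕ → ℤ

-- Skew-symmetry: Q(x,y) = - Q(y,x).  AF = raw quivers with this property.
IsQuiver : RawQuiver → Set
IsQuiver Q = ∀ x y → Q x y ≡ - Q y x

[_]₊ : ℤ → ℤ
[ a ]₊ = a ⊔ 0ℤ

μ : ℕ → RawQuiver → RawQuiver
μ x Q v w with x ≟ v | x ≟ w
... | yes _ | _     = - Q v w
... | no _  | yes _ = - Q v w
... | no _  | no _  = Q v w + Q v x * [ Q x w ]₊ + [ - Q v x ]₊ * Q x w

-- A mutation sequence i : ℕ → ℕ  (i 0 is the paper's i_1, etc.).
-- iter i Q m = μ_{i_m} ∘ ... ∘ μ_{i_1} (Q)  (m mutations).
iter : (ℕ → ℕ) → RawQuiver → ℕ → RawQuiver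
iter i Q zero    = Q
iter i Q (suc m) = μ (i m) (iter i Q m)

-- Finite subsets V of vertices are given by lists.
-- ρ_V(Q) = ρ_V(Q'), stated pointwise.
AgreeOn : List ℕ → RawQuiver → RawQuiver → Set
AgreeOn V Q Q' = ∀ x y → x ∈ V → y ∈ V → Q x y ≡ Q' x y

-- Convergence in AF of a sequence of quivers: there is a limit quiver L in AF
-- such that every basic neighbourhood U_{L,V} eventually contains the sequence.
ConvergesTo : (ℕ → RawQuiver) → RawQuiver → Set
ConvergesTo s L = ∀ (V : List ℕ) → ∃ λ M → ∀ m → M ≤ m → AgreeOn V (s m) L

Converges : (ℕ → RawQuiver) → Set
Converges s = ∃ λ L → IsQuiver L × ConvergesTo s L

MutConverges : (ℕ → ℕ) → RawQuiver → Set
MutConverges i Q = Converges (λ m → iter i Q (suc m))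

C-AF : (ℕ → ℕ) → RawQuiver → Set
C-AF i Q = MutConverges i Q

D-AF : (ℕ → ℕ) → RawQuiver → Set
D-AF i Q = ¬ MutConverges i Q

-- A subset S of AF is dense: it meets every nonempty basic open set U_{Q,V}.
Dense : (RawQuiver → Set) → Set
Dense S = ∀ (Q : RawQuiver) → IsQuiver Q → ∀ (V : List ℕ) →
          ∃ λ Q' → IsQuiver Q' × AgreeOn V Q' Q × S Q'

AppearsFinitelyOften : (ℕ → ℕ) → ℕ → Set
AppearsFinitelyOften i j = ∃ λ N → ∀ m → N ≤ m → ¬ (i m ≡ j)

FinitelyManyValues : (ℕ → ℕ) → Set
FinitelyManyValues i = ∃ λ (L : List ℕ) → ∀ m → i m ∈ L

{-# OPTIONS --safe #-}
-- Write i₀, i₁, … for the mutated vertices.  (ii) Cut Q down to a finite vertex set containing V.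
-- (iii) If the mutated vertices span no arrows and are all joined to a further vertex z, their
-- arrows to z keep changing sign.
--
-- (i) One cannot decide which vertices recur in i, so a single construction has to work for every i.
-- Take two new vertices with one arrow a → b.  At time m, the vertices z entering the picture, among
-- them i m if it is still new, get arrows so that in the m-th quiver there are two arrows a → z, two
-- arrows z → b, and one arrow x → z for each x isolated among the earlier vertices; mutating back
-- gives the arrows at time 0.  Suppose the orbit converges, and let K bound the vertices present when
-- Q(a,b) has become constant.  Q(a,b) is always odd, so a and b are no longer mutated.  A vertex
-- z ≥ K keeps its arrows to a and b until it is mutated, which would add 4 to Q(a,b); so only
-- vertices below K are mutated.  Convergence makes all their arrows to vertices in any given finite
-- set vanish eventually, but such an isolated vertex is joined to the next new vertex.
module Submission where

open import Defs
open import Data.Empty using (⊥)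
open import Data.Nat using (ℕ; zero; suc; _≤_; _<_; _⊔_; z≤n; s≤s; _≤′_; ≤′-refl; ≤′-step)
open import Data.Nat.Properties
  using (_≟_; _<?_; ≤-refl; ≤-trans; ≤-total; <-≤-trans; <⇒≢; <⇒≤; <⇒≱; ≮⇒≥; n<1+n;
         m≤n⇒m≤1+n; ≤∧≢⇒<; ≤-pred; ⊔-comm; m≤m⊔n; m≤n⊔m; ≤⇒≤′; ≤′⇒≤; allUpTo?)
open import Data.Integer using (ℤ; +_; -[1+_]; _+_; _*_; -_; 0ℤ; 1ℤ)
import Data.Integer.Properties as ℤ
open import Algebra.Properties.AbelianGroup ℤ.+-0-abelianGroup using (identityʳ-unique)
open import Data.Integer.Divisibility.Signed
  using (_∣_; _∣?_; ∣-refl; ∣m∣n⇒∣m+n; ∣m⇒∣-m; ∣m⇒∣m*n; ∣n⇒∣m*n)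
open import Data.Integer.Tactic.RingSolver using (solve-∀)
open import Data.List using (List; []; _∷_; upTo)
open import Data.List.Membership.Propositional using (_∈_)
open import Data.List.Membership.Propositional.Properties using (∈-upTo⁺)
open import Data.List.Relation.Unary.Any using (here; there)
open import Data.Product using (∃; _×_; _,_; proj₁; proj₂)
open import Data.Sum using (_⊎_; inj₁; inj₂)
open import Function using (_∘_; const; case_of_)
open import Relation.Nullary using (¬_; Dec; yes; no; contradiction)
open import Relation.Nullary.Decidable using (from-no)
open import Relation.Binary.PropositionalEquality
  using (_≡_; _≢_; refl; sym; trans; cong; subst; ≢-sym)

-- Induction, finite sets and integers

≤-induction : (P : ℕ → Set) {m : ℕ} → P m →
              (∀ n → m ≤ n → P n → P (suc n)) → ∀ n → m ≤ n → P n
≤-induction P {m} base step n m≤n = go (≤⇒≤′ m≤n)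
  where
  go : ∀ {n} → m ≤′ n → P n
  go ≤′-refl        = base
  go (≤′-step m≤′n) = step _ (≤′⇒≤ m≤′n) (go m≤′n)

list-bounded : (V : List ℕ) → ∃ λ n → ∀ {x} → x ∈ V → x < n
list-bounded []      = 0 , λ ()
list-bounded (v ∷ V) with list-bounded V
... | n , V<n = suc v ⊔ n , λ where
  (here refl) → m≤m⊔n (suc v) n
  (there x∈V) → ≤-trans (V<n x∈V) (m≤n⊔m (suc v) n)

i≡-i⇒i≡0 : ∀ {i} → i ≡ - i → i ≡ 0ℤ
i≡-i⇒i≡0 {+ zero}   _ = refl
i≡-i⇒i≡0 {+ suc _}  ()
i≡-i⇒i≡0 { -[1+ _ ]} ()

-i≡0⇒i≡0 : ∀ {i} → - i ≡ 0ℤ → i ≡ 0ℤ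
-i≡0⇒i≡0 = ℤ.neg-injective

-- Removes `[ a ]₊` in favour of `[ - a ]₊`, so that identities between mutated entries become
-- polynomial and fall to the ring solver.
[]₊-split : ∀ a → [ a ]₊ ≡ a + [ - a ]₊
[]₊-split (+ zero)   = refl
[]₊-split (+ suc n)  = sym (ℤ.+-identityʳ (+ suc n))
[]₊-split (-[1+ n ]) = sym (ℤ.+-inverseʳ (+ suc n))

∣⇒∣[]₊ : ∀ {d} a → d ∣ a → d ∣ [ a ]₊
∣⇒∣[]₊ {d} a d∣a with ℤ.⊔-sel a 0ℤ
... | inj₁ eq = subst (d ∣_) (sym eq) d∣a
... | inj₂ eq = subst (d ∣_) (sym eq) (∣n⇒∣m*n {d} 0ℤ ∣-refl)

-- Single mutations

μ-sourceˡ : ∀ x Q w → μ x Q x w ≡ - Q x w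
μ-sourceˡ x Q w with x ≟ x
... | yes _   = refl
... | no x≢x = contradiction refl x≢x

μ-targetʳ : ∀ x Q v → μ x Q v x ≡ - Q v x
μ-targetʳ x Q v with x ≟ v | x ≟ x
... | yes _ | _       = refl
... | no _  | yes _   = refl
... | no _  | no x≢x = contradiction refl x≢x

μ-elsewhere : ∀ {x v w} Q → x ≢ v → x ≢ w →
              μ x Q v w ≡ Q v w + Q v x * [ Q x w ]₊ + [ - Q v x ]₊ * Q x w
μ-elsewhere {x} {v} {w} Q x≢v x≢w with x ≟ v | x ≟ w
... | yes x≡v | _       = contradiction x≡v x≢v
... | no _    | yes x≡w = contradiction x≡w x≢w
... | no _    | no _    = refl

data Position (x v w : ℕ) : Set where
  source    : x ≡ v → Position x v w
  target    : x ≡ w → Position x v w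
  elsewhere : x ≢ v → x ≢ w → Position x v w

position : ∀ x v w → Position x v w
position x v w with x ≟ v | x ≟ w
... | yes x≡v | _       = source x≡v
... | no _    | yes x≡w = target x≡w
... | no x≢v  | no x≢w  = elsewhere x≢v x≢w

μ-cong : ∀ {x v w P Q} → P v w ≡ Q v w → P v x ≡ Q v x → P x w ≡ Q x w → μ x P v w ≡ μ x Q v w
μ-cong {x} {v} {w} vw vx xw with x ≟ v | x ≟ w
... | yes _ | _     = cong -_ vw
... | no _  | yes _ = cong -_ vw
... | no _  | no _  rewrite vw | vx | xw = refl

μ-fixes : ∀ {x v w} Q → x ≢ v → x ≢ w → Q v x ≡ 0ℤ ⊎ Q x w ≡ 0ℤ → μ x Q v w ≡ Q v w
μ-fixes {x} {v} {w} Q x≢v x≢w zero-factor = trans (μ-elsewhere Q x≢v x≢w) (no-path zero-factor)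
  where
  no-path : Q v x ≡ 0ℤ ⊎ Q x w ≡ 0ℤ → Q v w + Q v x * [ Q x w ]₊ + [ - Q v x ]₊ * Q x w ≡ Q v w
  no-path (inj₁ eq) rewrite eq = lemma (Q v w) [ Q x w ]₊ (Q x w)
    where
    lemma : ∀ q b c → q + 0ℤ * b + 0ℤ * c ≡ q
    lemma = solve-∀
  no-path (inj₂ eq) rewrite eq = lemma (Q v w) (Q v x) [ - Q v x ]₊
    where
    lemma : ∀ q b c → q + b * 0ℤ + c * 0ℤ ≡ q
    lemma = solve-∀

μ-zero : ∀ {x v w} Q → Q v w ≡ 0ℤ → Q v x ≡ 0ℤ ⊎ Q x w ≡ 0ℤ → μ x Q v w ≡ 0ℤ
μ-zero {x} {v} {w} Q vw zero-factor with position x v w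
... | source refl       = trans (μ-sourceˡ x Q w) (cong -_ vw)
... | target refl       = trans (μ-targetʳ x Q v) (cong -_ vw)
... | elsewhere x≢v x≢w = trans (μ-fixes Q x≢v x≢w zero-factor) vw

μ-zero⁻ : ∀ {x v w} Q → Q v x ≡ 0ℤ ⊎ Q x w ≡ 0ℤ → μ x Q v w ≡ 0ℤ → Q v w ≡ 0ℤ
μ-zero⁻ {x} {v} {w} Q zero-factor eq with position x v w
... | source refl       = -i≡0⇒i≡0 (trans (sym (μ-sourceˡ x Q w)) eq)
... | target refl       = -i≡0⇒i≡0 (trans (sym (μ-targetʳ x Q v)) eq)
... | elsewhere x≢v x≢w = trans (sym (μ-fixes Q x≢v x≢w zero-factor)) eq

-- Each correction term is a product of one factor from `Q v x` and one from `Q x w`, and negating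
-- or truncating a factor keeps its divisors.
μ-∣ : ∀ {d x v w} Q → d ∣ Q v w → d ∣ Q v x ⊎ d ∣ Q x w → d ∣ μ x Q v w
μ-∣ {d} {x} {v} {w} Q d∣vw factor with x ≟ v | x ≟ w
... | yes _ | _     = ∣m⇒∣-m d∣vw
... | no _  | yes _ = ∣m⇒∣-m d∣vw
... | no _  | no _  with factor
...   | inj₁ d∣vx = ∣m∣n⇒∣m+n (∣m∣n⇒∣m+n d∣vw (∣m⇒∣m*n _ d∣vx))
                              (∣m⇒∣m*n (Q x w) (∣⇒∣[]₊ (- Q v x) (∣m⇒∣-m d∣vx)))
...   | inj₂ d∣xw = ∣m∣n⇒∣m+n (∣m∣n⇒∣m+n d∣vw (∣n⇒∣m*n (Q v x) (∣⇒∣[]₊ (Q x w) d∣xw)))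
                              (∣n⇒∣m*n [ - Q v x ]₊ d∣xw)

μ-involutive : ∀ x Q v w → μ x (μ x Q) v w ≡ Q v w
μ-involutive x Q v w with position x v w
... | source refl = trans (μ-sourceˡ x (μ x Q) w)
                          (trans (cong -_ (μ-sourceˡ x Q w)) (ℤ.neg-involutive _))
... | target refl = trans (μ-targetʳ x (μ x Q) v)
                          (trans (cong -_ (μ-targetʳ x Q v)) (ℤ.neg-involutive _))
... | elsewhere x≢v x≢w
  rewrite μ-elsewhere (μ x Q) x≢v x≢w | μ-elsewhere Q x≢v x≢w
        | μ-targetʳ x Q v | μ-sourceˡ x Q w | ℤ.neg-involutive (Q v x)
        | []₊-split (Q v x) | []₊-split (Q x w)
  = lemma (Q v w) (Q v x) (Q x w) [ - Q v x ]₊ [ - Q x w ]₊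
  where
  lemma : ∀ q a b s t → (q + a * (b + t) + s * b) + (- a) * t + (a + s) * (- b) ≡ q
  lemma = solve-∀

μ-isQuiver : ∀ x {Q} → IsQuiver Q → IsQuiver (μ x Q)
μ-isQuiver x {Q} skew v w with position x v w
... | source refl = trans (μ-sourceˡ x Q w)
                          (cong -_ (trans (skew x w) (sym (μ-targetʳ x Q w))))
... | target refl = trans (μ-targetʳ x Q v)
                          (cong -_ (trans (skew v x) (sym (μ-sourceˡ x Q v))))
... | elsewhere x≢v x≢w =
  trans (μ-elsewhere Q x≢v x≢w)
    (trans (reverse _ (Q v x) (Q x w) (skew v w) (skew w x) (skew x v))
           (cong -_ (sym (μ-elsewhere Q x≢w x≢v))))
  where
  lemma : ∀ q a b s t → - q + a * (b + t) + s * b ≡ - (q + (- b) * s + (b + t) * (- a))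
  lemma = solve-∀

  -- With s = `[ - a ]₊` and t = `[ - b ]₊` the correction is a * b + a * t + s * b, which reversing
  -- the path v, x, w only negates.
  reverse : ∀ {q a′ b′} q′ a b → q ≡ - q′ → b′ ≡ - b → a′ ≡ - a →
            q + a * [ b ]₊ + [ - a ]₊ * b ≡ - (q′ + b′ * [ a′ ]₊ + [ - b′ ]₊ * a′)
  reverse q′ a b refl refl refl rewrite ℤ.neg-involutive b | []₊-split b =
    lemma q′ a b [ - a ]₊ [ - b ]₊

-- Mutation sequences restricted to the vertices below a bound

AgreeBelow : ℕ → RawQuiver → RawQuiver → Set
AgreeBelow n P Q = ∀ {x y} → x < n → y < n → P x y ≡ Q x y

AgreeBelow-sym : ∀ {n P Q} → AgreeBelow n P Q → AgreeBelow n Q P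
AgreeBelow-sym agree x<n y<n = sym (agree x<n y<n)

μ-agreeBelow : ∀ {n v P Q} → v < n → AgreeBelow n P Q → AgreeBelow n (μ v P) (μ v Q)
μ-agreeBelow {P = P} {Q} v<n agree x<n y<n =
  μ-cong {P = P} {Q} (agree x<n y<n) (agree x<n v<n) (agree v<n y<n)

iter-isQuiver : ∀ i {Q} m → IsQuiver Q → IsQuiver (iter i Q m)
iter-isQuiver i zero    skew = skew
iter-isQuiver i (suc m) skew = μ-isQuiver (i m) (iter-isQuiver i m skew)

undo : (ℕ → ℕ) → ℕ → RawQuiver → RawQuiver
undo i zero    Q = Q
undo i (suc m) Q = undo i m (μ (i m) Q)

undo-isQuiver : ∀ i m {Q} → IsQuiver Q → IsQuiver (undo i m Q)
undo-isQuiver i zero    skew = skew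
undo-isQuiver i (suc m) skew = undo-isQuiver i m (μ-isQuiver (i m) skew)

PlayedBelow : (ℕ → ℕ) → ℕ → ℕ → Set
PlayedBelow i m n = ∀ k → k < m → i k < n

PlayedBelow-pred : ∀ {i m n} → PlayedBelow i (suc m) n → PlayedBelow i m n
PlayedBelow-pred played k k<m = played k (m≤n⇒m≤1+n k<m)

iter-agreeBelow : ∀ {i n P Q} m → PlayedBelow i m n →
                  AgreeBelow n P Q → AgreeBelow n (iter i P m) (iter i Q m)
iter-agreeBelow zero    played agree = agree
iter-agreeBelow {i} {n} {P} {Q} (suc m) played agree =
  μ-agreeBelow {P = iter i P m} {iter i Q m} (played m ≤-refl)
    (iter-agreeBelow {P = P} {Q} m (PlayedBelow-pred played) agree)

undo-agreeBelow : ∀ {i n P Q} m → PlayedBelow i m n →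
                  AgreeBelow n P Q → AgreeBelow n (undo i m P) (undo i m Q)
undo-agreeBelow zero    played agree = agree
undo-agreeBelow {i} {n} {P} {Q} (suc m) played agree =
  undo-agreeBelow {P = μ (i m) P} {μ (i m) Q} m (PlayedBelow-pred played)
    (μ-agreeBelow {P = P} {Q} (played m ≤-refl) agree)

-- The innermost pair of mutations cancels by `μ-involutive`. This holds only entry by entry, so
-- `undo-agreeBelow` carries it through the remaining mutations, all of them at vertices below n.
undo-iter : ∀ {i n} Q m → PlayedBelow i m n → AgreeBelow n (undo i m (iter i Q m)) Q
undo-iter Q zero    played _ _ = refl
undo-iter {i} Q (suc m) played x<n y<n =
  trans (undo-agreeBelow {P = μ (i m) (μ (i m) (iter i Q m))} m below
          (λ _ _ → μ-involutive (i m) (iter i Q m) _ _) x<n y<n)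
        (undo-iter Q m below x<n y<n)
  where below = PlayedBelow-pred played

iter-undo : ∀ {i n} Q m → PlayedBelow i m n → AgreeBelow n (iter i (undo i m Q) m) Q
iter-undo Q zero    played _ _ = refl
iter-undo {i} Q (suc m) played x<n y<n =
  trans (μ-agreeBelow {P = iter i (undo i m (μ (i m) Q)) m} {μ (i m) Q} (played m ≤-refl)
          (iter-undo (μ (i m) Q) m (PlayedBelow-pred played)) x<n y<n)
        (μ-involutive (i m) Q _ _)

-- Adjoining vertices

glue : ℕ → RawQuiver → (ℕ → ℤ) → RawQuiver
glue n Q c x y with x <? n | y <? n
... | yes _ | yes _ = Q x y
... | yes _ | no _  = c x
... | no _  | yes _ = - c y
... | no _  | no _  = 0ℤ

glue-isQuiver : ∀ n {Q} c → IsQuiver Q → IsQuiver (glue n Q c)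
glue-isQuiver n c skew x y with x <? n | y <? n
... | yes _ | yes _ = skew x y
... | yes _ | no _  = sym (ℤ.neg-involutive (c x))
... | no _  | yes _ = refl
... | no _  | no _  = refl

glue-below : ∀ n Q c → AgreeBelow n (glue n Q c) Q
glue-below n Q c {x} {y} x<n y<n with x <? n | y <? n
... | yes _   | yes _   = refl
... | yes _   | no y≮n = contradiction y<n y≮n
... | no x≮n | _       = contradiction x<n x≮n

glue-across : ∀ {n x y} Q c → x < n → n ≤ y → glue n Q c x y ≡ c x
glue-across {n} {x} {y} Q c x<n n≤y with x <? n | y <? n
... | yes _   | yes y<n = contradiction n≤y (<⇒≱ y<n)
... | yes _   | no _    = refl
... | no x≮n | _       = contradiction x<n x≮n

-- Convergent orbits, and claims (ii) and (iii)

convergent⇒stable : ∀ {i Q} → MutConverges i Q → ∀ n →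
  ∃ λ M → ∀ {l m} → M ≤ l → M ≤ m → AgreeBelow n (iter i Q l) (iter i Q m)
convergent⇒stable {i} {Q} (L , _ , toL) n with toL (upTo n)
-- The shift by one arises because the sequence in `MutConverges` starts after the first mutation.
... | M , near = suc M , λ M<l M<m x<n y<n → trans (limit M<l x<n y<n) (sym (limit M<m x<n y<n))
  where
  limit : ∀ {m x y} → M < m → x < n → y < n → iter i Q m x y ≡ L x y
  limit {suc m} {x} {y} (s≤s M≤m) x<n y<n = near m M≤m x y (∈-upTo⁺ x<n) (∈-upTo⁺ y<n)

-- A mutation at x negates every entry of row x.
stable⇒zero-at-mutated : ∀ i Q m {y} → iter i Q (suc m) (i m) y ≡ iter i Q m (i m) y →
                         iter i Q m (i m) y ≡ 0ℤ
stable⇒zero-at-mutated i Q m stable = i≡-i⇒i≡0 (trans (sym stable) (μ-sourceˡ (i m) (iter i Q m) _))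

-- The finitely many arrows below n freeze once the vertices below n are no longer mutated.
convergent-dense : ∀ i → (∀ j → AppearsFinitelyOften i j) → Dense (C-AF i)
convergent-dense i finitely Q skew V with list-bounded V
... | n , V<n = Q₀ , skew₀
  , (λ x y x∈V y∈V → glue-below n Q (const 0ℤ) (V<n x∈V) (V<n y∈V))
  , iter i Q₀ N , iter-isQuiver i N skew₀
  , λ _ → N , λ m N≤m x y _ _ → constant (suc m) (m≤n⇒m≤1+n N≤m) x y
  where
  -- No vertex from n on ever acquires an arrow, so mutating there changes nothing, and the quiver
  -- at time `N` is the limit.
  Q₀ = glue n Q (const 0ℤ)

  skew₀ : IsQuiver Q₀
  skew₀ = glue-isQuiver n (const 0ℤ) skew

  last-below : ∀ n → ∃ λ N → ∀ m → N ≤ m → n ≤ i m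
  last-below zero    = 0 , λ _ _ → z≤n
  last-below (suc n) with last-below n | finitely n
  ... | N₁ , ≥n | N₂ , ≢n = N₁ ⊔ N₂ , λ m N≤m →
    ≤∧≢⇒< (≥n m (≤-trans (m≤m⊔n N₁ N₂) N≤m))
                              (≢-sym (≢n m (≤-trans (m≤n⊔m N₁ N₂) N≤m)))

  N = proj₁ (last-below n)

  supported : ∀ m {x} y → n ≤ x → iter i Q₀ m x y ≡ 0ℤ
  supported zero {x} y n≤x with x <? n | y <? n
  ... | yes x<n | _     = contradiction n≤x (<⇒≱ x<n)
  ... | no _    | yes _ = refl
  ... | no _    | no _  = refl
  supported (suc m) y n≤x = μ-zero (iter i Q₀ m) (supported m y n≤x) (inj₁ (supported m (i m) n≤x))

  unmoved : ∀ m → n ≤ i m → ∀ x y → iter i Q₀ (suc m) x y ≡ iter i Q₀ m x y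
  unmoved m n≤im x y with position (i m) x y
  ... | source refl = trans (supported (suc m) y n≤im) (sym (supported m y n≤im))
  ... | target refl = trans (into (suc m)) (sym (into m))
    where
    into : ∀ l → iter i Q₀ l x (i m) ≡ 0ℤ
    into l = trans (iter-isQuiver i l skew₀ x (i m)) (cong -_ (supported l x n≤im))
  ... | elsewhere ≢x ≢y = μ-fixes (iter i Q₀ m) ≢x ≢y (inj₂ (supported m y n≤im))

  constant : ∀ m → N ≤ m → ∀ x y → iter i Q₀ m x y ≡ iter i Q₀ N x y
  constant = ≤-induction _ (λ _ _ → refl) λ m N≤m eq x y →
    trans (unmoved m (proj₂ (last-below n) m N≤m) x y) (eq x y)

-- If the mutated vertices span no arrows, the arrows from them to a further vertex z only change
-- sign, and one of them does so at every step.
convergent-not-dense : ∀ i → FinitelyManyValues i → ¬ Dense (C-AF i)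
convergent-not-dense i (L , i∈L) dense = nonzero M (i<z M) zero-at-M
  where
  z = proj₁ (list-bounded L)

  i<z : ∀ m → i m < z
  i<z m = proj₂ (list-bounded L) (i∈L m)

  star : RawQuiver
  star = glue z (λ _ _ → 0ℤ) (const 1ℤ)

  -- The neighbourhood of `star` given by the vertices up to z contains no point of convergence;
  -- density would supply one.
  meets = dense star (glue-isQuiver z (const 1ℤ) λ _ _ → refl) (upTo (suc z))

  Q = proj₁ meets

  Q-star : AgreeBelow (suc z) Q star
  Q-star x≤z y≤z = proj₁ (proj₂ (proj₂ meets)) _ _ (∈-upTo⁺ x≤z) (∈-upTo⁺ y≤z)

  discrete : ∀ m {x y} → x < z → y < z → iter i Q m x y ≡ 0ℤ
  discrete zero    x<z y<z =
    trans (Q-star (m≤n⇒m≤1+n x<z) (m≤n⇒m≤1+n y<z)) (glue-below z _ (const 1ℤ) x<z y<z)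
  discrete (suc m) x<z y<z =
    μ-zero (iter i Q m) (discrete m x<z y<z) (inj₁ (discrete m x<z (i<z m)))

  nonzero : ∀ m {x} → x < z → iter i Q m x z ≢ 0ℤ
  nonzero zero x<z eq with trans (sym eq)
    (trans (Q-star (m≤n⇒m≤1+n x<z) (n<1+n z)) (glue-across _ (const 1ℤ) x<z ≤-refl))
  ... | ()
  nonzero (suc m) x<z eq =
    nonzero m x<z (μ-zero⁻ (iter i Q m) (inj₁ (discrete m x<z (i<z m))) eq)

  stable = convergent⇒stable {i} {Q} (proj₂ (proj₂ (proj₂ meets))) (suc z)
  M = proj₁ stable

  zero-at-M : iter i Q M (i M) z ≡ 0ℤ
  zero-at-M = stable⇒zero-at-mutated i Q M
    (proj₂ stable (m≤n⇒m≤1+n ≤-refl) ≤-refl (m≤n⇒m≤1+n (i<z M)) (n<1+n z))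

-- Isolated vertices, for claim (i)

Isolated : ℕ → RawQuiver → ℕ → Set
Isolated n P x = ∀ {y} → y < n → P x y ≡ 0ℤ

-- `column` branches on this test, so isolation is measured against finitely many vertices only.
isolated? : ∀ n P x → Dec (Isolated n P x)
isolated? n P x = allUpTo? (λ y → P x y ℤ.≟ 0ℤ) n

isolated-mono : ∀ {m n} P {x} → m ≤ n → Isolated n P x → Isolated m P x
isolated-mono P m≤n isolated y<m = isolated (<-≤-trans y<m m≤n)

isolated-agree : ∀ {n P R x} → AgreeBelow n P R → x < n → Isolated n R x → Isolated n P x
isolated-agree agree x<n isolated y<n = trans (agree x<n y<n) (isolated y<n)

isolated-μ : ∀ {n v} P {x} → v < n → Isolated n P x → Isolated n (μ v P) x
isolated-μ P v<n isolated y<n = μ-zero P (isolated y<n) (inj₁ (isolated v<n))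

-- Construction of the divergent quiver

module Generic (i : ℕ → ℕ) (n : ℕ) (Q : RawQuiver) (skew : IsQuiver Q) where

  a b : ℕ
  a = n
  b = suc n

  -- Vertex v receives its arrows to smaller vertices at the unique time m with
  -- bound m ≤ v < bound (suc m); it cannot have been mutated before that time.
  bound : ℕ → ℕ
  bound zero    = suc (suc n)
  bound (suc m) = suc (bound m ⊔ i m)

  bound-suc : ∀ m → bound m < bound (suc m)
  bound-suc m = s≤s (m≤m⊔n (bound m) (i m))

  played<bound : ∀ m → i m < bound (suc m)
  played<bound m = s≤s (m≤n⊔m (bound m) (i m))

  bound-mono : ∀ {l m} → l ≤ m → bound l ≤ bound m
  bound-mono {l} {m} = ≤-induction (λ m → bound l ≤ bound m) ≤-refl
    (λ m _ le → ≤-trans le (<⇒≤ (bound-suc m))) m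

  <bound : ∀ m → m < bound m
  <bound zero    = s≤s z≤n
  <bound (suc m) = s≤s (≤-trans (<bound m) (m≤m⊔n (bound m) (i m)))

  playedBelow : ∀ m → PlayedBelow i m (bound m)
  playedBelow m k k<m = <-≤-trans (played<bound k) (bound-mono k<m)

  a<bound : ∀ m → a < bound m
  a<bound m = <-≤-trans (m≤n⇒m≤1+n ≤-refl) (bound-mono {0} {m} z≤n)

  b<bound : ∀ m → b < bound m
  b<bound m = <-≤-trans ≤-refl (bound-mono {0} {m} z≤n)

  a≢b : a ≢ b
  a≢b = <⇒≢ ≤-refl

  -- A new vertex z lies on a path a → z → b of even weights and is joined to every vertex that
  -- is isolated at this moment.
  column : ℕ → RawQuiver → ℕ → ℤ
  column k P x with x ≟ a | x ≟ b | isolated? k P x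
  ... | yes _ | _     | _     = + 2
  ... | no _  | yes _ | _     = - + 2
  ... | no _  | no _  | yes _ = 1ℤ
  ... | no _  | no _  | no _  = 0ℤ

  column-a : ∀ k P → column k P a ≡ + 2
  column-a k P with a ≟ a
  ... | yes _   = refl
  ... | no a≢a = contradiction refl a≢a

  column-b : ∀ k P → column k P b ≡ - + 2
  column-b k P with b ≟ a | b ≟ b
  ... | yes b≡a | _       = contradiction (sym b≡a) a≢b
  ... | no _    | yes _   = refl
  ... | no _    | no b≢b = contradiction refl b≢b

  column-rest : ∀ k P x → x ≢ a → x ≢ b →
    (Isolated k P x × column k P x ≡ 1ℤ) ⊎ (¬ Isolated k P x × column k P x ≡ 0ℤ)
  column-rest k P x x≢a x≢b with x ≟ a | x ≟ b | isolated? k P x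
  ... | yes x≡a | _       | _            = contradiction x≡a x≢a
  ... | no _    | yes x≡b | _            = contradiction x≡b x≢b
  ... | no _    | no _    | yes isolated = inj₁ (isolated , refl)
  ... | no _    | no _    | no joined    = inj₂ (joined , refl)

  δₐ : ℕ → ℤ
  δₐ x with x ≟ a
  ... | yes _ = 1ℤ
  ... | no _  = 0ℤ

  -- Adjoins a with no arrow to a smaller vertex, then b with the single arrow a → b. Entries at
  -- vertices beyond b are discarded by the first gluing in `extended`.
  base : RawQuiver
  base = glue b (glue a Q (const 0ℤ)) δₐ

  -- approx m has the prescribed arrows below bound m; undo pulls the arrows chosen at time m back
  -- to time 0.
  approx : ℕ → RawQuiver
  extended : ℕ → RawQuiver
  approx zero    = base
  approx (suc m) = undo i m (extended m)
  extended m = glue (bound m) (iter i (approx m) m) (column (bound m) (iter i (approx m) m))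

  approx-isQuiver : ∀ m → IsQuiver (approx m)
  approx-isQuiver zero    = glue-isQuiver b δₐ (glue-isQuiver a (const 0ℤ) skew)
  approx-isQuiver (suc m) = undo-isQuiver i m
    (glue-isQuiver (bound m) (column (bound m) (iter i (approx m) m))
      (iter-isQuiver i m (approx-isQuiver m)))

  approx-step : ∀ m → AgreeBelow (bound m) (approx (suc m)) (approx m)
  approx-step m x<k y<k = trans
    (undo-agreeBelow {P = extended m} m (playedBelow m) (glue-below (bound m) _ _) x<k y<k)
    (undo-iter (approx m) m (playedBelow m) x<k y<k)

  approx-stable : ∀ {l} m → l ≤ m → AgreeBelow (bound l) (approx m) (approx l)
  approx-stable {l} = ≤-induction (λ m → AgreeBelow (bound l) (approx m) (approx l))
    (λ _ _ → refl) λ m l≤m agree x<k y<k → trans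
      (approx-step m (<-≤-trans x<k (bound-mono l≤m)) (<-≤-trans y<k (bound-mono l≤m)))
      (agree x<k y<k)

  -- The limit of the `approx m`: both x and y lie below `bound (x ⊔ y)`, where `approx (x ⊔ y)`
  -- already has its final entries.
  generic : RawQuiver
  generic x y = approx (x ⊔ y) x y

  generic-approx : ∀ m → AgreeBelow (bound m) generic (approx m)
  generic-approx m {x} {y} x<k y<k with ≤-total (x ⊔ y) m
  ... | inj₁ le = sym (approx-stable m le (<-≤-trans (s≤s (m≤m⊔n x y)) (<bound (x ⊔ y)))
                                          (<-≤-trans (s≤s (m≤n⊔m x y)) (<bound (x ⊔ y))))
  ... | inj₂ ge = approx-stable (x ⊔ y) ge x<k y<k

  generic-isQuiver : IsQuiver generic
  generic-isQuiver x y rewrite ⊔-comm x y = approx-isQuiver (y ⊔ x) x y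

  base-below : AgreeBelow a base Q
  base-below x<a y<a = trans (glue-below b _ δₐ (m≤n⇒m≤1+n x<a) (m≤n⇒m≤1+n y<a))
                             (glue-below a Q (const 0ℤ) x<a y<a)

  generic-below : AgreeBelow a generic Q
  generic-below x<a y<a =
    trans (generic-approx 0 (≤-trans x<a (<⇒≤ (a<bound 0))) (≤-trans y<a (<⇒≤ (a<bound 0))))
          (base-below x<a y<a)

  -- The orbit of the constructed quiver

  state : ℕ → RawQuiver
  state = iter i generic

  state-isQuiver : ∀ m → IsQuiver (state m)
  state-isQuiver m = iter-isQuiver i m generic-isQuiver

  state-approx : ∀ m → AgreeBelow (bound m) (state m) (iter i (approx m) m)
  state-approx m = iter-agreeBelow {P = generic} m (playedBelow m) (generic-approx m)

  -- The first m mutations cancel the `undo` in `approx (suc m)`. The range includes the vertices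
  -- entering at time m, so their arrows at that time are the prescribed ones.
  state-extended : ∀ m → AgreeBelow (bound (suc m)) (state m) (extended m)
  state-extended m x<k y<k = trans
    (iter-agreeBelow {P = generic} m below (generic-approx (suc m)) x<k y<k)
    (iter-undo (extended m) m below x<k y<k)
    where
    below : PlayedBelow i m (bound (suc m))
    below = PlayedBelow-pred (playedBelow (suc m))

  New : ℕ → ℕ → Set
  New m z = bound m ≤ z × z < bound (suc m)

  state-new : ∀ m {x z} → x < bound m → New m z →
              state m x z ≡ column (bound m) (iter i (approx m) m) x
  state-new m x<k (k≤z , z<k′) =
    trans (state-extended m (≤-trans x<k (<⇒≤ (bound-suc m))) z<k′) (glue-across _ _ x<k k≤z)

  new-a : ∀ m {z} → New m z → state m a z ≡ + 2
  new-a m new = trans (state-new m (a<bound m) new) (column-a (bound m) _)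

  new-b : ∀ m {z} → New m z → state m b z ≡ - + 2
  new-b m new = trans (state-new m (b<bound m) new) (column-b (bound m) _)

  new-rest : ∀ m {x z} → x < bound m → x ≢ a → x ≢ b → New m z →
    (Isolated (bound m) (state m) x × state m x z ≡ 1ℤ) ⊎
    (¬ Isolated (bound m) (state m) x × state m x z ≡ 0ℤ)
  new-rest m {x} x<k x≢a x≢b new with column-rest (bound m) (iter i (approx m) m) x x≢a x≢b
  ... | inj₁ (isolated , eq) = inj₁
    ( isolated-agree {P = state m} (state-approx m) x<k isolated
    , trans (state-new m x<k new) eq)
  ... | inj₂ (joined , eq)   = inj₂
    ( joined ∘ isolated-agree {R = state m} (AgreeBelow-sym {P = state m} (state-approx m)) x<k
    , trans (state-new m x<k new) eq)

  -- The parity invariant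

  Even : ℤ → Set
  Even = + 2 ∣_

  -- Modulo 2, a and b are joined to each other and to nothing else below k. Mutation below k, even
  -- at a or b, preserves this: every path that alters an arrow at a or b has an even factor.
  record Parity (k : ℕ) (P : RawQuiver) : Set where
    field
      odd-ab : ¬ Even (P a b)
      even-a : ∀ {y} → y < k → y ≢ a → y ≢ b → Even (P a y)
      even-b : ∀ {y} → y < k → y ≢ a → y ≢ b → Even (P b y)

  even-0 : Even 0ℤ
  even-0 = ∣n⇒∣m*n {+ 2} 0ℤ ∣-refl

  parity-μ : ∀ {k v P} → v < k → Parity k P → Parity k (μ v P)
  parity-μ {k} {v} {P} v<k parity = record
    { odd-ab = odd′ ; even-a = even-a′ ; even-b = even-b′ }
    where
    open Parity parity

    odd′ : ¬ Even (μ v P a b)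
    odd′ even with position v a b
    ... | source refl       =
      odd-ab (subst Even (trans (cong -_ (μ-sourceˡ v P b)) (ℤ.neg-involutive _)) (∣m⇒∣-m even))
    ... | target refl       =
      odd-ab (subst Even (trans (cong -_ (μ-targetʳ v P a)) (ℤ.neg-involutive _)) (∣m⇒∣-m even))
    -- Mutating back at v would carry evenness over to `P a b`.
    ... | elsewhere v≢a v≢b =
      odd-ab (subst Even (μ-involutive v P a b)
        (μ-∣ (μ v P) even (inj₁ (subst Even (sym (μ-targetʳ v P a)) (∣m⇒∣-m (even-a v<k v≢a v≢b))))))

    even-a′ : ∀ {y} → y < k → y ≢ a → y ≢ b → Even (μ v P a y)
    even-a′ {y} y<k y≢a y≢b = μ-∣ P (even-a y<k y≢a y≢b) factor
      where
      factor : Even (P a v) ⊎ Even (P v y)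
      factor with v ≟ a | v ≟ b
      ... | yes refl | _        = inj₂ (even-a y<k y≢a y≢b)
      ... | no _     | yes refl = inj₂ (even-b y<k y≢a y≢b)
      ... | no v≢a   | no v≢b   = inj₁ (even-a v<k v≢a v≢b)

    even-b′ : ∀ {y} → y < k → y ≢ a → y ≢ b → Even (μ v P b y)
    even-b′ {y} y<k y≢a y≢b = μ-∣ P (even-b y<k y≢a y≢b) factor
      where
      factor : Even (P b v) ⊎ Even (P v y)
      factor with v ≟ a | v ≟ b
      ... | yes refl | _        = inj₂ (even-a y<k y≢a y≢b)
      ... | no _     | yes refl = inj₂ (even-b y<k y≢a y≢b)
      ... | no v≢a   | no v≢b   = inj₁ (even-b v<k v≢a v≢b)

  base-a : ∀ {y} → b ≤ y → base a y ≡ 1ℤ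
  base-a b≤y = trans (glue-across {b} _ δₐ ≤-refl b≤y) δₐ-a
    where
    δₐ-a : δₐ a ≡ 1ℤ
    δₐ-a with a ≟ a
    ... | yes _   = refl
    ... | no a≢a = contradiction refl a≢a

  parity-base : Parity (bound 0) base
  parity-base = record
    { odd-ab = subst (¬_ ∘ Even) (sym (base-a ≤-refl)) (from-no (+ 2 ∣? 1ℤ))
    ; even-a = λ y<k y≢a y≢b → subst Even (sym (base-a-below (<a y<k y≢a y≢b))) even-0
    ; even-b = λ y<k y≢a y≢b → subst Even (sym (base-b-below (<a y<k y≢a y≢b))) even-0
    }
    where
    <a : ∀ {y} → y < bound 0 → y ≢ a → y ≢ b → y < a
    <a y<k y≢a y≢b = ≤∧≢⇒< (≤-pred (≤∧≢⇒< (≤-pred y<k) y≢b)) y≢a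

    base-a-below : ∀ {y} → y < a → base a y ≡ 0ℤ
    base-a-below {y} y<a = trans (approx-isQuiver 0 a y)
      (cong -_ (trans (glue-below b _ δₐ (m≤n⇒m≤1+n y<a) ≤-refl)
                      (glue-across Q (const 0ℤ) y<a ≤-refl)))

    base-b-below : ∀ {y} → y < a → base b y ≡ 0ℤ
    base-b-below {y} y<a = trans (approx-isQuiver 0 b y)
      (cong -_ (trans (glue-across {b} _ δₐ (m≤n⇒m≤1+n y<a) ≤-refl) δₐ-below))
      where
      δₐ-below : δₐ y ≡ 0ℤ
      δₐ-below with y ≟ a
      ... | yes y≡a = contradiction y≡a (<⇒≢ y<a)
      ... | no _    = refl

  parity-agree : ∀ {k P R} → a < k → b < k → AgreeBelow k P R → Parity k R → Parity k P
  parity-agree a<k b<k agree parity = record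
    { odd-ab = odd-ab ∘ subst Even (agree a<k b<k)
    ; even-a = λ y<k y≢a y≢b → subst Even (sym (agree a<k y<k)) (even-a y<k y≢a y≢b)
    ; even-b = λ y<k y≢a y≢b → subst Even (sym (agree b<k y<k)) (even-b y<k y≢a y≢b)
    }
    where open Parity parity

  parity-new : ∀ m → Parity (bound m) (state m) → Parity (bound (suc m)) (state m)
  parity-new m parity = record
    { odd-ab = odd-ab
    ; even-a = λ {y} y<k′ y≢a y≢b → case y <? bound m of λ where
        (yes y<k) → even-a y<k y≢a y≢b
        (no y≮k)  → subst Even (sym (new-a m (≮⇒≥ y≮k , y<k′))) ∣-refl
    ; even-b = λ {y} y<k′ y≢a y≢b → case y <? bound m of λ where
        (yes y<k) → even-b y<k y≢a y≢b
        (no y≮k)  → subst Even (sym (new-b m (≮⇒≥ y≮k , y<k′))) (∣m⇒∣-m ∣-refl)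
    }
    where open Parity parity

  parity : ∀ m → Parity (bound m) (state m)
  parity zero    = parity-agree {P = generic} (a<bound 0) (b<bound 0) (generic-approx 0) parity-base
  parity (suc m) = parity-μ (played<bound m) (parity-new m (parity m))

  ab≢0 : ∀ m → state m a b ≢ 0ℤ
  ab≢0 m eq = Parity.odd-ab (parity m) (subst Even (sym eq) even-0)

  -- Divergence

  ab-moves : ∀ m {z} → z ≡ i m → z ≢ a → z ≢ b → state m a z ≡ + 2 → state m b z ≡ - + 2 →
             state (suc m) a b ≢ state m a b
  ab-moves m {z} refl z≢a z≢b az bz eq = four≢0 (identityʳ-unique (state m a b) (+ 4) (trans (sym sum) eq))
    where
    four≢0 : + 4 ≢ 0ℤ
    four≢0 ()

    zb : state m z b ≡ + 2
    zb = trans (state-isQuiver m z b) (cong -_ bz)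

    -- The path a → z → b contributes 2 * 2; the last summand is zero because -2 truncates to 0.
    weight : ∀ {q p r} → p ≡ + 2 → r ≡ + 2 → q + p * [ r ]₊ + [ - p ]₊ * r ≡ q + + 4
    weight {q} refl refl = ℤ.+-identityʳ (q + + 4)

    sum : state (suc m) a b ≡ state m a b + + 4
    sum = trans (μ-elsewhere (state m) z≢a z≢b) (weight {state m a b} az zb)

  divergent : ¬ MutConverges i generic
  divergent convergent = impossible
    where
    stable : ∀ k → ∃ λ M → ∀ {l m} → M ≤ l → M ≤ m → AgreeBelow k (state l) (state m)
    stable = convergent⇒stable {i} {generic} convergent

    M₁ = proj₁ (stable (bound 0))
    K = bound M₁

    ab-stable : ∀ m → M₁ ≤ m → state (suc m) a b ≡ state m a b
    ab-stable m M₁≤m = proj₂ (stable (bound 0)) (m≤n⇒m≤1+n M₁≤m) M₁≤m (a<bound 0) (b<bound 0)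

    ≢a : ∀ m → M₁ ≤ m → i m ≢ a
    ≢a m M₁≤m refl = ab≢0 m (stable⇒zero-at-mutated i generic m (ab-stable m M₁≤m))

    ≢b : ∀ m → M₁ ≤ m → i m ≢ b
    ≢b m M₁≤m eq = ab≢0 m (i≡-i⇒i≡0 (trans (sym (ab-stable m M₁≤m)) (negated eq)))
      where
      negated : ∀ {v} → v ≡ b → μ v (state m) a b ≡ - state m a b
      negated refl = μ-targetʳ b (state m) a

    -- As long as only vertices x < K other than a and b are mutated, the arrows from a vertex
    -- z ≥ K to a and b are untouched: x is not joined to z, or it is isolated below K.
    record Fresh (P : RawQuiver) (z : ℕ) : Set where
      field
        az   : P a z ≡ + 2
        bz   : P b z ≡ - + 2
        rest : ∀ {x} → x < K → x ≢ a → x ≢ b → P x z ≡ 0ℤ ⊎ Isolated K P x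

    fresh-new : ∀ m → M₁ ≤ m → ∀ {z} → New m z → Fresh (state m) z
    fresh-new m M₁≤m {z} new = record { az = new-a m new ; bz = new-b m new ; rest = rest }
      where
      rest : ∀ {x} → x < K → x ≢ a → x ≢ b → state m x z ≡ 0ℤ ⊎ Isolated K (state m) x
      rest x<K x≢a x≢b with new-rest m (<-≤-trans x<K (bound-mono M₁≤m)) x≢a x≢b new
      ... | inj₁ (isolated , _) = inj₂ (isolated-mono (state m) (bound-mono M₁≤m) isolated)
      ... | inj₂ (_ , xz)       = inj₁ xz

    fresh-μ : ∀ {P v z} → IsQuiver P → v < K → v ≢ a → v ≢ b → K ≤ z → Fresh P z → Fresh (μ v P) z
    fresh-μ {P} {v} {z} skewP v<K v≢a v≢b K≤z fresh = record
      { az   = trans (μ-fixes P v≢a v≢z (no-path (a<bound M₁))) az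
      ; bz   = trans (μ-fixes P v≢b v≢z (no-path (b<bound M₁))) bz
      ; rest = rest′
      }
      where
      open Fresh fresh

      v≢z : v ≢ z
      v≢z = <⇒≢ (<-≤-trans v<K K≤z)

      no-path : ∀ {x} → x < K → P x v ≡ 0ℤ ⊎ P v z ≡ 0ℤ
      no-path {x} x<K with rest v<K v≢a v≢b
      ... | inj₁ vz       = inj₂ vz
      ... | inj₂ isolated = inj₁ (trans (skewP x v) (cong -_ (isolated x<K)))

      rest′ : ∀ {x} → x < K → x ≢ a → x ≢ b → μ v P x z ≡ 0ℤ ⊎ Isolated K (μ v P) x
      rest′ x<K x≢a x≢b with rest x<K x≢a x≢b
      ... | inj₁ xz       = inj₁ (μ-zero P xz (no-path x<K))
      ... | inj₂ isolated = inj₂ (isolated-μ P v<K isolated)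

    AllFresh : ℕ → ℕ → Set
    AllFresh k m = ∀ z → K ≤ z → z < k → Fresh (state m) z

    allFresh-new : ∀ m → M₁ ≤ m → AllFresh (bound m) m → AllFresh (bound (suc m)) m
    allFresh-new m M₁≤m fresh z K≤z z<k′ with z <? bound m
    ... | yes z<k = fresh z K≤z z<k
    ... | no z≮k  = fresh-new m M₁≤m (≮⇒≥ z≮k , z<k′)

    allFresh⇒played<K : ∀ m → M₁ ≤ m → AllFresh (bound (suc m)) m → i m < K
    allFresh⇒played<K m M₁≤m fresh with i m <? K
    ... | yes im<K = im<K
    ... | no im≮K = contradiction (ab-stable m M₁≤m)
      (ab-moves m refl (≢a m M₁≤m) (≢b m M₁≤m) (Fresh.az im-fresh) (Fresh.bz im-fresh))
      where im-fresh = fresh (i m) (≮⇒≥ im≮K) (played<bound m)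

    -- Nothing is claimed at time `M₁`, where the bound is `K`. In the step, the vertices entering
    -- at time m, possibly `i m` itself, are fresh before the mutation; this forces `i m` below `K`,
    -- so the mutation preserves freshness.
    allFresh : ∀ m → M₁ ≤ m → AllFresh (bound m) m
    allFresh = ≤-induction (λ m → AllFresh (bound m) m)
      (λ z K≤z z<K → contradiction K≤z (<⇒≱ z<K))
      λ m M₁≤m fresh z K≤z z<k → let fresh′ = allFresh-new m M₁≤m fresh in
        fresh-μ (state-isQuiver m) (allFresh⇒played<K m M₁≤m fresh′) (≢a m M₁≤m) (≢b m M₁≤m) K≤z
                (fresh′ z K≤z z<k)

    played<K : ∀ m → M₁ ≤ m → i m < K
    played<K m M₁≤m = allFresh⇒played<K m M₁≤m (allFresh-new m M₁≤m (allFresh m M₁≤m))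

    -- Arrows below `K` are constant from `M₂` on, and those below `k₂`, which covers the vertices
    -- entering at time `M₂`, from `M₃` on. Being mutated at time `M₃`, x has no arrows below `k₂`
    -- then; this is traced back to time `M₂`.
    M₂ = M₁ ⊔ proj₁ (stable K)
    k₂ = bound (suc M₂)
    M₃ = M₂ ⊔ proj₁ (stable k₂)
    x = i M₃

    M₁≤M₂ : M₁ ≤ M₂
    M₁≤M₂ = m≤m⊔n M₁ (proj₁ (stable K))

    M₂≤M₃ : M₂ ≤ M₃
    M₂≤M₃ = m≤m⊔n M₂ (proj₁ (stable k₂))

    M₁≤M₃ : M₁ ≤ M₃
    M₁≤M₃ = ≤-trans M₁≤M₂ M₂≤M₃

    x<K : x < K
    x<K = played<K M₃ M₁≤M₃

    vanishes : ∀ {y} → y < k₂ → state M₃ x y ≡ 0ℤ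
    vanishes y<k₂ = stable⇒zero-at-mutated i generic M₃
      (proj₂ (stable k₂) (m≤n⇒m≤1+n (m≤n⊔m M₂ _)) (m≤n⊔m M₂ _)
        (<-≤-trans x<K (bound-mono (m≤n⇒m≤1+n M₁≤M₂))) y<k₂)

    x-isolated : ∀ m → M₂ ≤ m → Isolated K (state m) x
    x-isolated m M₂≤m y<K = trans
      (proj₂ (stable K) (≤-trans (m≤n⊔m M₁ _) M₂≤m) (≤-trans (m≤n⊔m M₁ _) M₂≤M₃) x<K y<K)
      (vanishes (<-≤-trans y<K (bound-mono (m≤n⇒m≤1+n M₁≤M₂))))

    -- Row x can only change sign after time M₂.
    vanished : ∀ {y} m → M₂ ≤ m → state m x y ≡ 0ℤ → state M₂ x y ≡ 0ℤ
    vanished {y} = ≤-induction (λ m → state m x y ≡ 0ℤ → state M₂ x y ≡ 0ℤ) (λ eq → eq)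
      λ m M₂≤m back eq → back (μ-zero⁻ (state m)
        (inj₁ (x-isolated m M₂≤m (played<K m (≤-trans M₁≤M₂ M₂≤m)))) eq)

    x-isolated-at-M₂ : Isolated k₂ (state M₂) x
    x-isolated-at-M₂ y<k₂ = vanished M₃ M₂≤M₃ (vanishes y<k₂)

    impossible : ⊥
    -- The vertex `bound M₂` enters at time `M₂` and lies below `k₂`. Either x has an arrow to it,
    -- or x was already joined to an earlier vertex; isolation below `k₂` excludes both.
    impossible with new-rest M₂ (<-≤-trans x<K (bound-mono M₁≤M₂)) (≢a M₃ M₁≤M₃) (≢b M₃ M₁≤M₃)
                             (≤-refl , bound-suc M₂)
    ... | inj₁ (_ , xz) with trans (sym xz) (x-isolated-at-M₂ (bound-suc M₂))
    ...   | ()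
    impossible | inj₂ (joined , _) =
      joined (isolated-mono (state M₂) (<⇒≤ (bound-suc M₂)) x-isolated-at-M₂)

divergent-dense : ∀ i → Dense (D-AF i)
divergent-dense i Q skew V with list-bounded V
... | n , V<n = generic , generic-isQuiver
  , (λ x y x∈V y∈V → generic-below (V<n x∈V) (V<n y∈V)) , divergent
  where open Generic i n Q skew

theorem1p3 : (i : ℕ → ℕ) →
    Dense (D-AF i)
    × ((∀ j → AppearsFinitelyOften i j) → Dense (C-AF i))
    × (FinitelyManyValues i → ¬ Dense (C-AF i))
theorem1p3 i = divergent-dense i , convergent-dense i , convergent-not-dense i
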